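{- Let $p$ be an odd prime and take $k=1$. For every $s\ge3$ and $0\le t\le p-1$, the $p$-Fibonacci number of the vertex $V_{s,t}=\lambda\big(p(2sp-(2s+1)),\,p(sp-(s+1))+t\big)$ is $$\mathcal M_{V_{s,t}}=\begin{cases}\dfrac{p^{s-3}(p-1)}{2}\Big(2(s-1)p^2+2t-(2s-5)\Big), & 0\le t<\frac{p-1}{2},\\[6pt] \dfrac{p^{s-3}(p-1)}{2}\Big(2(s-1)p^2+2t-2p-(2s-5)\Big), & \frac{p-1}{2}\le t\le p-1.\end{cases}$$
   Context: Fix an odd prime $p$ and an integer $k\ge 0$. For integers $0\le i<n$ write $\lambda(n,i)=(n-i,1^i)$ for the hook partition of $n$ with $n-i$ boxes in its first row and $i$ further boxes in its first column. If $\mu=\lambda(n',i')$ is obtained from $\lambda(n,i)$ by appending $m=(n'-i')-(n-i)\ge 0$ boxes to the first row and $n''=i'-i\ge 0$ boxes to the first column, we say $\mu$ is obtained by adding the block $B_{m,n''}$ ($m$ horizontal nodes, $n''$ vertical nodes). Put $x_s=p^k(sp-(s+1))$. The relevant part ("column $k$") of the $p$-Bratteli diagram is the graded directed graph with vertices: on floor $2k+1$, $S_i=\lambda(p^k(p-1),i)$ for $0\le i<p^k(p-1)$; on floor $2(k+s)$ ($s\ge1$), $V_{s,l}=\lambda\big(p^k(2sp-(2s+1)),\,x_s+l\big)$ for $0\le l<p^k$; on floor $2(k+s)-1$ ($s\ge2$), $W_{s,l'}=\lambda\big(p^k((2s-1)p-2s),\,x_{s-1}+l'\big)$ for $0\le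 l'<p^{k+1}$; and edges, each labelled by the block added: (E1) $S_i\to V_{1,l}$ exactly when $i=p^kt+l$ with $0\le t\le p-2$, block $B_{p^kt,\,p^k(p-2-t)}$; (E2) for $s\ge2$, $0\le l<p^k$, $0\le\beta\le p-1$: $V_{s-1,l}\to W_{s,pl+\beta}$, block $B_{p^k(p-1)-((p-1)l+\beta),\,(p-1)l+\beta}$; (E3) for $s\ge 2$, $0\le l'<p^{k+1}$ and $t=\lfloor l'/p^k\rfloor$: $W_{s,l'}\to V_{s,l'-p^kt}$, block $B_{p^kt,\,p^k(p-1-t)}$. A path ending at a vertex $v$ is a sequence of edges starting at some $S_i$ and going up one floor at a time to $v$ ($S_i\to V_{1,\cdot}\to W_{2,\cdot}\to V_{2,\cdot}\to W_{3,\cdot}\to\cdots\to v$); $\mathcal P(v)$ is the set of all paths ending at $v$. The blocks of a path are numbered $B^2,B^3,\dots,B^N$: $B^2$ is the block of the edge leaving $S_i$, and for $j\ge2$, $B^{2j-1}$ is the block of the edge into $W_{j,\cdot}$ and $B^{2j}$ the block of the edge into $V_{j,\cdot}$. Write $B^j=B_{m_j,n_j}$. Descents: $1\in\mathrm{Des}(P)$ iff $m_2=p^kt$ with $0\le t<\frac{p-1}{2}$; $2\notin\mathrm{Des}(P)$; for $3\le j<N$, $j\in\mathrm{Des}(P)$ iff $m_j>m_{j+1}$ and $n_j<n_{j+1}$. $\mathrm{des}(P)=|\mathrm{Des}(P)|$. The $p^k$-Fibonacci number of a vertex $v$ is $\mathcal M_v=\sum_{P\in\mathcal P(v)}\mathrm{des}(P)$.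 -}

module Defs where

open import Data.Fin.Base using (Fin; toℕ)
open import Data.Fin.Properties using (any?; toℕ<n; toℕ≤pred[n])
open import Data.List.Base using (List; []; _∷_; [_]; map; concatMap; replicate; filter; upTo; length; allFin)
open import Data.List.Membership.Propositional using (_∈_)
open import Data.List.Membership.Propositional.Properties using (∈-map⁺; ∈-map⁻; ∈-allFin; ∈-++⁺ˡ; ∈-++⁺ʳ; ∈-++⁻)
open import Data.List.Relation.Unary.All using ([])
open import Data.List.Relation.Unary.Any using (here; there)
open import Data.List.Relation.Unary.AllPairs using ([]; _∷_)
open import Data.List.Relation.Unary.All.Properties using (All¬⇒¬Any)
open import Data.List.Relation.Unary.Unique.Propositional using (Unique)
open import Data.List.Relation.Unary.Unique.Propositional.Properties using (map⁺; allFin⁺; ++⁺)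
open import Data.Nat.Base
open import Data.Nat.Divisibility using (_∣_)
open import Data.Nat.DivMod using (_/_; m/n*n≤m; m<n*o⇒m/o<n)
open import Data.Nat.ListAction using (sum)
open import Data.Nat.Primality using (Prime; prime⇒nonZero; prime⇒nonTrivial)
open import Data.Nat.Properties
open import Data.Nat.Tactic.RingSolver using (solve-∀)
open import Data.Product.Base using (Σ; Σ-syntax; _×_; _,_; proj₁; proj₂)
open import Data.Empty using (⊥)
open import Data.Sum.Base using (inj₁; inj₂)
open import Relation.Binary.PropositionalEquality using (_≡_; refl; sym; trans; cong; cong₂; subst; module ≡-Reasoning)
open import Relation.Nullary using (¬_; Dec; yes; no; contradiction; recompute; _×-dec_)

-- The hook partition λ(size, leg) = (size - leg, 1^leg).
record Hook : Set where
  constructor hook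
  field
    size leg  : ℕ
    .leg<size : leg < size

  arm : ℕ
  arm = size ∸ leg

  parts : List ℕ
  parts = arm ∷ replicate leg 1

-- B m n is the block with m horizontal and n vertical nodes.
record Block : Set where
  constructor B
  field
    horizontal vertical : ℕ

open Block public

AddsBlock : Hook → Block → Hook → Set
AddsBlock h b h′ =
  Hook.arm h′ ≡ Hook.arm h + horizontal b × Hook.leg h′ ≡ Hook.leg h + vertical b

-- A duplicate-free list of all elements of a type.
record Enumeration (A : Set) : Set where
  field
    elements : List A
    unique   : Unique elements
    complete : ∀ a → a ∈ elements

open Enumeration public

sumOver : ∀ {A} → Enumeration A → (A → ℕ) → ℕ
sumOver xs f = sum (map f (elements xs))

enumFin : ∀ n → Enumeration (Fin n)
enumFin n = record { elements = allFin n ; unique = allFin⁺ n ; complete = ∈-allFin }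

enumDec : ∀ {A : Set} → (∀ (x y : A) → x ≡ y) → Dec A → Enumeration A
enumDec irr (yes a) = record
  { elements = [ a ] ; unique = [] ∷ [] ; complete = λ x → here (irr x a) }
enumDec irr (no ¬a) = record
  { elements = [] ; unique = [] ; complete = λ x → contradiction x ¬a }

module _ {A C : Set} (f : A → C) (g : C → A) (gf : ∀ a → g (f a) ≡ a) (fg : ∀ c → f (g c) ≡ c) where

  enumMap : Enumeration A → Enumeration C
  enumMap xs = record
    { elements = map f (elements xs)
    ; unique   = map⁺ (λ {x} {y} eq → trans (sym (gf x)) (trans (cong g eq) (gf y))) (unique xs)
    ; complete = λ c → subst (_∈ map f (elements xs)) (fg c) (∈-map⁺ f (complete xs (g c)))
    }

module _ {A : Set} {F : A → Set} (ys : ∀ a → Enumeration (F a)) where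

  pairs : List A → List (Σ A F)
  pairs = concatMap (λ a → map (a ,_) (elements (ys a)))

  pairs⁺ : ∀ {xs a} → a ∈ xs → (b : F a) → (a , b) ∈ pairs xs
  pairs⁺ (here refl) b = ∈-++⁺ˡ (∈-map⁺ _ (complete (ys _) b))
  pairs⁺ {x ∷ _} (there a∈) b = ∈-++⁺ʳ (map (x ,_) (elements (ys x))) (pairs⁺ a∈ b)

  pairs⁻ : ∀ xs {ab} → ab ∈ pairs xs → proj₁ ab ∈ xs
  pairs⁻ (x ∷ xs) ab∈ with ∈-++⁻ (map (x ,_) (elements (ys x))) ab∈
  ... | inj₂ ab∈′ = there (pairs⁻ xs ab∈′)
  ... | inj₁ ab∈′ with _ , _ , refl ← ∈-map⁻ _ ab∈′ = here refl

  pairs-unique : ∀ {xs} → Unique xs → Unique (pairs xs)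
  pairs-unique [] = []
  pairs-unique {x ∷ xs} (x∉ ∷ xs!) =
    ++⁺ (map⁺ (λ { refl → refl }) (unique (ys x))) (pairs-unique xs!) disjoint
    where
    disjoint : ∀ {ab} → ¬ (ab ∈ map (x ,_) (elements (ys x)) × ab ∈ pairs xs)
    disjoint (p , q) with _ , _ , refl ← ∈-map⁻ _ p = All¬⇒¬Any x∉ (pairs⁻ xs q)

  enumΣ : Enumeration A → Enumeration (Σ A F)
  enumΣ xs = record
    { elements = pairs (elements xs)
    ; unique   = pairs-unique (unique xs)
    ; complete = λ (a , b) → pairs⁺ (complete xs a) b
    }

module Column (p : ℕ) (p-prime : Prime p) (p-odd : ¬ 2 ∣ p) (k : ℕ) where

  instance
    p≢0 : NonZero p
    p≢0 = prime⇒nonZero p-prime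

    p^k≢0 : NonZero (p ^ k)
    p^k≢0 = m^n≢0 p k

  x : ℕ → ℕ
  x s = p ^ k * (s * p ∸ (s + 1))

  data Vertex : Set where
    S : Fin (p ^ k * (p ∸ 1)) → Vertex
    V : (s : ℕ) .{{_ : NonZero s}} → Fin (p ^ k) → Vertex
    W : (s : ℕ) .{{_ : NonTrivial s}} → Fin (p ^ (k + 1)) → Vertex

  floor : Vertex → ℕ
  floor (S _)   = 2 * k + 1
  floor (V s _) = 2 * (k + s)
  floor (W s _) = 2 * (k + s) ∸ 1

  private
    1<p : 1 < p
    1<p = nonTrivial⇒n>1 p {{prime⇒nonTrivial p-prime}}

    D : ℕ → ℕ
    D a = a * p ∸ (a + 1)

    a+1≤a*p : ∀ a .{{_ : NonZero a}} → a + 1 ≤ a * p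
    a+1≤a*p a = begin
      a + 1     ≤⟨ +-monoʳ-≤ a (>-nonZero⁻¹ a) ⟩
      a + a     ≡⟨ double a ⟩
      a * 2     ≤⟨ *-monoʳ-≤ a 1<p ⟩
      a * p     ∎
      where
      open ≤-Reasoning
      double : ∀ a → a + a ≡ a * 2
      double = solve-∀

    D-suc : ∀ a .{{_ : NonZero a}} → D (suc a) ≡ (p ∸ 1) + D a
    D-suc a = begin
      p + a * p ∸ (1 + (a + 1))  ≡⟨ ∸-+-assoc (p + a * p) 1 (a + 1) ⟨
      p + a * p ∸ 1 ∸ (a + 1)    ≡⟨ cong (_∸ (a + 1)) (+-∸-comm (a * p) (<⇒≤ 1<p)) ⟩
      (p ∸ 1) + a * p ∸ (a + 1)  ≡⟨ +-∸-assoc (p ∸ 1) (a+1≤a*p a) ⟩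
      (p ∸ 1) + D a              ∎
      where open ≡-Reasoning

    D-+ : ∀ b a .{{_ : NonZero a}} → D (b + a) ≡ b * (p ∸ 1) + D a
    D-+ zero          a       = refl
    D-+ (suc b) a@(suc a′) = begin
      D (suc (b + a))                      ≡⟨ D-suc (b + a) {{subst NonZero (sym (+-suc b a′)) _}} ⟩
      (p ∸ 1) + D (b + a)                  ≡⟨ cong ((p ∸ 1) +_) (D-+ b a) ⟩
      (p ∸ 1) + (b * (p ∸ 1) + D a)        ≡⟨ +-assoc (p ∸ 1) _ _ ⟨
      (p ∸ 1) + b * (p ∸ 1) + D a          ∎
      where open ≡-Reasoning

    bound : ∀ a c d l → l < p ^ k * c → c + a ≤ d → p ^ k * a + l < p ^ k * d
    bound a c d l l< le = begin-strict
      p ^ k * a + l          <⟨ +-monoʳ-< (p ^ k * a) l< ⟩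
      p ^ k * a + p ^ k * c  ≡⟨ *-distribˡ-+ (p ^ k) a c ⟨
      p ^ k * (a + c)        ≡⟨ cong (p ^ k *_) (+-comm a c) ⟩
      p ^ k * (c + a)        ≤⟨ *-monoʳ-≤ (p ^ k) le ⟩
      p ^ k * d              ∎
      where open ≤-Reasoning

    V-bound : ∀ s .{{_ : NonZero s}} (l : Fin (p ^ k)) →
              x s + toℕ l < p ^ k * (2 * s * p ∸ (2 * s + 1))
    V-bound s@(suc s′) l = bound (D s) 1 (D (2 * s)) (toℕ l)
      (subst (toℕ l <_) (sym (*-identityʳ (p ^ k))) (toℕ<n l))
      (begin
        1 + D s              ≤⟨ +-monoˡ-≤ (D s) (≤-trans (∸-monoˡ-≤ 1 1<p) (m≤m+n (p ∸ 1) _)) ⟩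
        s * (p ∸ 1) + D s    ≡⟨ D-+ s s ⟨
        D (s + s)            ≡⟨ cong (λ z → D (s + z)) (+-identityʳ s) ⟨
        D (2 * s)            ∎)
      where open ≤-Reasoning

    p^[k+1] : p ^ (k + 1) ≡ p ^ k * p
    p^[k+1] = trans (^-distribˡ-+-* p k 1) (cong (p ^ k *_) (*-identityʳ p))

    W-size : ∀ s → (2 * s ∸ 1) * p ∸ 2 * s ≡ D (2 * s ∸ 1)
    W-size zero    = refl
    W-size (suc s) = cong ((2 * suc s ∸ 1) * p ∸_) (+-comm 1 (2 * suc s ∸ 1))

    W-bound : ∀ s .{{_ : NonTrivial s}} (l : Fin (p ^ (k + 1))) →
              x (s ∸ 1) + toℕ l < p ^ k * ((2 * s ∸ 1) * p ∸ 2 * s)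
    W-bound s@(2+ r) l = bound (D (suc r)) p _ (toℕ l)
      (subst (toℕ l <_) p^[k+1] (toℕ<n l))
      (begin
        p + D (suc r)                           ≡⟨ cong (_+ D (suc r)) (m+[n∸m]≡n (<⇒≤ 1<p)) ⟨
        1 + (p ∸ 1) + D (suc r)                 ≤⟨ +-monoˡ-≤ (D (suc r)) (+-mono-≤ (∸-monoˡ-≤ 1 1<p) (m≤m+n (p ∸ 1) _)) ⟩
        s * (p ∸ 1) + D (suc r)                 ≡⟨ D-+ s (suc r) ⟨
        D (s + suc r)                           ≡⟨ cong D (eq r) ⟩
        D (2 * s ∸ 1)                           ≡⟨ W-size s ⟨
        (2 * s ∸ 1) * p ∸ 2 * s                 ∎)
      where
      open ≤-Reasoning
      eq : ∀ r → 2+ r + suc r ≡ suc r + (2+ r + 0)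
      eq = solve-∀

  shape : Vertex → Hook
  shape (S i)   = hook (p ^ k * (p ∸ 1)) (toℕ i) (toℕ<n i)
  shape (V s l) = hook (p ^ k * (2 * s * p ∸ (2 * s + 1))) (x s + toℕ l) (V-bound s l)
  shape (W s l) = hook (p ^ k * ((2 * s ∸ 1) * p ∸ 2 * s)) (x (s ∸ 1) + toℕ l) (W-bound s l)

  data Edge : Vertex → Vertex → Set where
    E1 : ∀ {i l} (t : Fin (p ∸ 1)) →
         toℕ i ≡ p ^ k * toℕ t + toℕ l →
         Edge (S i) (V 1 l)
    E2 : ∀ {s l l′} (β : Fin p) →
         toℕ l′ ≡ p * toℕ l + toℕ β →
         Edge (V (suc s) l) (W (2+ s) l′)
    E3 : ∀ {s l′ l} →
         toℕ l ≡ toℕ l′ ∸ p ^ k * (toℕ l′ / p ^ k) →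
         Edge (W (2+ s) l′) (V (2+ s) l)

  label : ∀ {v w} → Edge v w → Block
  label (E1 t _) = B (p ^ k * toℕ t) (p ^ k * (p ∸ 2 ∸ toℕ t))
  label (E2 {l = l} β _) =
    B (p ^ k * (p ∸ 1) ∸ ((p ∸ 1) * toℕ l + toℕ β)) ((p ∸ 1) * toℕ l + toℕ β)
  label (E3 {l′ = l′} _) =
    B (p ^ k * (toℕ l′ / p ^ k)) (p ^ k * (p ∸ 1 ∸ toℕ l′ / p ^ k))

  floor-suc : ∀ {v w} → Edge v w → floor w ≡ suc (floor v)
  floor-suc (E1 _ _) = eq k
    where
    eq : ∀ k → 2 * (k + 1) ≡ suc (2 * k + 1)
    eq = solve-∀
  floor-suc (E2 {s = s} _ _) = cong (_∸ 1) (eq k s)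
    where
    eq : ∀ k s → 2 * (k + suc (suc s)) ≡ suc (suc (2 * (k + suc s)))
    eq = solve-∀
  floor-suc (E3 {s = s} _) rewrite +-suc k (suc s) = refl

  private
    fromSize : ∀ h b h′ →
      Hook.size h′ ≡ Hook.size h + (horizontal b + vertical b) →
      Hook.leg h′ ≡ Hook.leg h + vertical b → .(Hook.leg h < Hook.size h) → AddsBlock h b h′
    fromSize (hook n i _) (B a c) (hook _ _ _) refl refl i<n = arms , refl
      where
      open ≡-Reasoning
      i≤n : i ≤ n
      i≤n = <⇒≤ (recompute (i <? n) i<n)
      arms : n + (a + c) ∸ (i + c) ≡ n ∸ i + a
      arms = begin
        n + (a + c) ∸ (i + c)  ≡⟨ cong (_∸ (i + c)) (sym (+-assoc n a c)) ⟩
        n + a + c ∸ (i + c)    ≡⟨ [m+n]∸[o+n]≡m∸o (n + a) i c ⟩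
        n + a ∸ i              ≡⟨ +-∸-comm a i≤n ⟩
        n ∸ i + a              ∎
        where
        [m+n]∸[o+n]≡m∸o : ∀ m o n → m + n ∸ (o + n) ≡ m ∸ o
        [m+n]∸[o+n]≡m∸o m o n = trans (cong₂ _∸_ (+-comm m n) (+-comm o n)) ([m+n]∸[m+o]≡n∸o n m o)

    splitBlock : ∀ {t c} → t ≤ c → p ^ k * t + p ^ k * (c ∸ t) ≡ p ^ k * c
    splitBlock {t} {c} t≤c = trans (sym (*-distribˡ-+ (p ^ k) t (c ∸ t))) (cong (p ^ k *_) (m+[n∸m]≡n t≤c))

    size-step : ∀ a .{{_ : NonZero a}} → p ^ k * D (suc a) ≡ p ^ k * D a + p ^ k * (p ∸ 1)
    size-step a = trans (cong (p ^ k *_) (trans (D-suc a) (+-comm (p ∸ 1) (D a)))) (*-distribˡ-+ (p ^ k) (D a) (p ∸ 1))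

  label-adds : ∀ {v w} (e : Edge v w) → AddsBlock (shape v) (label e) (shape w)
  label-adds {v} {w} e@(E1 {i} {l} t i≡) = fromSize (shape v) (label e) (shape w) sizes legs (toℕ<n i)
    where
    open ≡-Reasoning
    t≤ : toℕ t ≤ p ∸ 2
    t≤ = subst (toℕ t ≤_) (pred[m∸n]≡m∸[1+n] p 1) (toℕ≤pred[n] t)
    D1 : D 1 ≡ p ∸ 2
    D1 = cong (_∸ 2) (*-identityˡ p)
    sizes : p ^ k * D 2 ≡ p ^ k * (p ∸ 1) + (p ^ k * toℕ t + p ^ k * (p ∸ 2 ∸ toℕ t))
    sizes = begin
      p ^ k * D 2                           ≡⟨ size-step 1 ⟩
      p ^ k * D 1 + p ^ k * (p ∸ 1)         ≡⟨ +-comm (p ^ k * D 1) _ ⟩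
      p ^ k * (p ∸ 1) + p ^ k * D 1         ≡⟨ cong (λ z → p ^ k * (p ∸ 1) + p ^ k * z) D1 ⟩
      p ^ k * (p ∸ 1) + p ^ k * (p ∸ 2)     ≡⟨ cong (p ^ k * (p ∸ 1) +_) (splitBlock t≤) ⟨
      p ^ k * (p ∸ 1) + (p ^ k * toℕ t + p ^ k * (p ∸ 2 ∸ toℕ t)) ∎
    swap : ∀ a b c → a + b + c ≡ a + c + b
    swap = solve-∀
    legs : x 1 + toℕ l ≡ toℕ i + p ^ k * (p ∸ 2 ∸ toℕ t)
    legs = begin
      p ^ k * D 1 + toℕ l                                       ≡⟨ cong (λ z → p ^ k * z + toℕ l) D1 ⟩
      p ^ k * (p ∸ 2) + toℕ l                                   ≡⟨ cong (_+ toℕ l) (splitBlock t≤) ⟨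
      p ^ k * toℕ t + p ^ k * (p ∸ 2 ∸ toℕ t) + toℕ l           ≡⟨ swap (p ^ k * toℕ t) _ _ ⟩
      p ^ k * toℕ t + toℕ l + p ^ k * (p ∸ 2 ∸ toℕ t)           ≡⟨ cong (_+ p ^ k * (p ∸ 2 ∸ toℕ t)) i≡ ⟨
      toℕ i + p ^ k * (p ∸ 2 ∸ toℕ t)                           ∎
  label-adds {v} {w} e@(E2 {s} {l} {l′} β l′≡) = fromSize (shape v) (label e) (shape w) sizes legs (V-bound (suc s) l)
    where
    open ≡-Reasoning
    c = (p ∸ 1) * toℕ l + toℕ β
    c≤ : c ≤ p ^ k * (p ∸ 1)
    c≤ = ≤-trans (+-monoʳ-≤ ((p ∸ 1) * toℕ l) (toℕ≤pred β))
         (≤-trans (≤-reflexive (trans (+-comm _ (p ∸ 1)) (trans (sym (*-suc (p ∸ 1) (toℕ l))) (*-comm (p ∸ 1) _))))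
                  (*-monoˡ-≤ (p ∸ 1) (toℕ<n l)))
      where
      toℕ≤pred : (β : Fin p) → toℕ β ≤ p ∸ 1
      toℕ≤pred β = ∸-monoˡ-≤ 1 (toℕ<n β)
    idx : ∀ s → suc s + (2+ s + 0) ≡ suc (2 * suc s)
    idx = solve-∀
    sizes : p ^ k * ((2 * 2+ s ∸ 1) * p ∸ 2 * 2+ s) ≡ p ^ k * D (2 * suc s) + ((p ^ k * (p ∸ 1) ∸ c) + c)
    sizes = begin
      p ^ k * ((2 * 2+ s ∸ 1) * p ∸ 2 * 2+ s)                     ≡⟨ cong (p ^ k *_) (W-size (2+ s)) ⟩
      p ^ k * D (2 * 2+ s ∸ 1)                                    ≡⟨ cong (λ z → p ^ k * D z) (idx s) ⟩
      p ^ k * D (suc (2 * suc s))                                 ≡⟨ size-step (2 * suc s) ⟩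
      p ^ k * D (2 * suc s) + p ^ k * (p ∸ 1)                     ≡⟨ cong (p ^ k * D (2 * suc s) +_) (m∸n+n≡m c≤) ⟨
      p ^ k * D (2 * suc s) + ((p ^ k * (p ∸ 1) ∸ c) + c)         ∎
    pl : p * toℕ l ≡ toℕ l + (p ∸ 1) * toℕ l
    pl = cong (_* toℕ l) (sym (m+[n∸m]≡n (<⇒≤ 1<p)))
    assoc4 : ∀ a b c d → a + (b + c + d) ≡ a + b + (c + d)
    assoc4 = solve-∀
    legs : x (suc s) + toℕ l′ ≡ x (suc s) + toℕ l + c
    legs = begin
      x (suc s) + toℕ l′                                          ≡⟨ cong (x (suc s) +_) (trans l′≡ (cong (_+ toℕ β) pl)) ⟩
      x (suc s) + (toℕ l + (p ∸ 1) * toℕ l + toℕ β)               ≡⟨ assoc4 (x (suc s)) (toℕ l) _ _ ⟩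
      x (suc s) + toℕ l + c                                       ∎
  label-adds {v} {w} e@(E3 {s} {l′} {l} l≡) = fromSize (shape v) (label e) (shape w) sizes legs (W-bound (2+ s) l′)
    where
    open ≡-Reasoning
    t = toℕ l′ / p ^ k
    t≤ : t ≤ p ∸ 1
    t≤ = ∸-monoˡ-≤ 1 (m<n*o⇒m/o<n {toℕ l′} {p} {p ^ k} (subst (toℕ l′ <_) (trans p^[k+1] (*-comm (p ^ k) p)) (toℕ<n l′)))
    qt≤ : p ^ k * t ≤ toℕ l′
    qt≤ = subst (_≤ toℕ l′) (*-comm t (p ^ k)) (m/n*n≤m (toℕ l′) (p ^ k))
    sizes : p ^ k * D (2 * 2+ s) ≡
            p ^ k * ((2 * 2+ s ∸ 1) * p ∸ 2 * 2+ s) + (p ^ k * t + p ^ k * (p ∸ 1 ∸ t))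
    sizes = begin
      p ^ k * D (2 * 2+ s)                              ≡⟨ size-step (2 * 2+ s ∸ 1) ⟩
      p ^ k * D (2 * 2+ s ∸ 1) + p ^ k * (p ∸ 1)        ≡⟨ cong₂ (λ y z → p ^ k * y + z) (W-size (2+ s)) (splitBlock t≤) ⟨
      p ^ k * ((2 * 2+ s ∸ 1) * p ∸ 2 * 2+ s) + (p ^ k * t + p ^ k * (p ∸ 1 ∸ t)) ∎
    shuffle : ∀ a b c d → a + (b + c) + d ≡ a + (b + d) + c
    shuffle = solve-∀
    legs : x (2+ s) + toℕ l ≡ x (suc s) + toℕ l′ + p ^ k * (p ∸ 1 ∸ t)
    legs = begin
      x (2+ s) + toℕ l                                                    ≡⟨ cong₂ _+_ (size-step (suc s)) l≡ ⟩
      x (suc s) + p ^ k * (p ∸ 1) + (toℕ l′ ∸ p ^ k * t)                  ≡⟨ cong (λ z → x (suc s) + z + (toℕ l′ ∸ p ^ k * t)) (splitBlock t≤) ⟨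
      x (suc s) + (p ^ k * t + p ^ k * (p ∸ 1 ∸ t)) + (toℕ l′ ∸ p ^ k * t) ≡⟨ shuffle (x (suc s)) (p ^ k * t) _ _ ⟩
      x (suc s) + (p ^ k * t + (toℕ l′ ∸ p ^ k * t)) + p ^ k * (p ∸ 1 ∸ t) ≡⟨ cong (λ z → x (suc s) + z + p ^ k * (p ∸ 1 ∸ t)) (m+[n∸m]≡n qt≤) ⟩
      x (suc s) + toℕ l′ + p ^ k * (p ∸ 1 ∸ t)                            ∎

  infixl 5 _▷_

  data Path : Vertex → Set where
    start : ∀ i → Path (S i)
    _▷_   : ∀ {v w} → Path v → Edge v w → Path w

  -- The index N of the last block; the first edge carries block number 2.
  top : ∀ {v} → Path v → ℕ
  top (start _) = 1
  top (P ▷ _)   = suc (top P)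

  -- The block numbered j; the value is meaningful only for 2 ≤ j ≤ top P.
  block : ∀ {v} → Path v → ℕ → Block
  block (start _) _ = B 0 0
  block (P ▷ e) j with j ≟ suc (top P)
  ... | yes _ = label e
  ... | no  _ = block P j

  IsDescent : ∀ {v} → Path v → ℕ → Set
  IsDescent P 0 = ⊥
  IsDescent P 1 = Σ[ t ∈ Fin ((p ∸ 1) / 2) ] horizontal (block P 2) ≡ p ^ k * toℕ t
  IsDescent P 2 = ⊥
  IsDescent P j@(suc (suc (suc _))) =
    horizontal (block P j) > horizontal (block P (suc j)) ×
    vertical (block P j) < vertical (block P (suc j))

  isDescent? : ∀ {v} (P : Path v) j → Dec (IsDescent P j)
  isDescent? P 0 = no λ ()
  isDescent? P 1 = any? λ t → horizontal (block P 2) ≟ p ^ k * toℕ t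
  isDescent? P 2 = no λ ()
  isDescent? P j@(suc (suc (suc _))) =
    (horizontal (block P (suc j)) <? horizontal (block P j)) ×-dec
    (vertical (block P j) <? vertical (block P (suc j)))

  Des : ∀ {v} → Path v → List ℕ
  Des P = filter (isDescent? P) (upTo (top P))

  des : ∀ {v} → Path v → ℕ
  des P = length (Des P)

  V₁-sources : Fin (p ^ k) → Set
  V₁-sources l = Σ[ i ∈ Fin (p ^ k * (p ∸ 1)) ] Σ[ t ∈ Fin (p ∸ 1) ] toℕ i ≡ p ^ k * toℕ t + toℕ l

  V₂-sources : ℕ → Fin (p ^ k) → Set
  V₂-sources s l = Σ[ l′ ∈ Fin (p ^ (k + 1)) ]
    Path (W (2+ s) l′) × toℕ l ≡ toℕ l′ ∸ p ^ k * (toℕ l′ / p ^ k)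

  W-sources : ℕ → Fin (p ^ (k + 1)) → Set
  W-sources s l′ = Σ[ l ∈ Fin (p ^ k) ] Path (V (suc s) l) ×
    (Σ[ β ∈ Fin p ] toℕ l′ ≡ p * toℕ l + toℕ β)

  toV₁ : ∀ {l} → V₁-sources l → Path (V 1 l)
  toV₁ (i , t , eq) = start i ▷ E1 t eq

  fromV₁ : ∀ {l} → Path (V 1 l) → V₁-sources l
  fromV₁ (start i ▷ E1 t eq) = i , t , eq

  toFromV₁ : ∀ {l} (P : Path (V 1 l)) → toV₁ (fromV₁ P) ≡ P
  toFromV₁ (start i ▷ E1 t eq) = refl

  toV₂ : ∀ {s l} → V₂-sources s l → Path (V (2+ s) l)
  toV₂ (_ , P , eq) = P ▷ E3 eq

  fromV₂ : ∀ {s l} → Path (V (2+ s) l) → V₂-sources s l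
  fromV₂ (P ▷ E3 eq) = _ , P , eq

  toFromV₂ : ∀ {s l} (P : Path (V (2+ s) l)) → toV₂ (fromV₂ P) ≡ P
  toFromV₂ (P ▷ E3 eq) = refl

  toW : ∀ {s l′} → W-sources s l′ → Path (W (2+ s) l′)
  toW (_ , P , β , eq) = P ▷ E2 β eq

  fromW : ∀ {s l′} → Path (W (2+ s) l′) → W-sources s l′
  fromW (P ▷ E2 β eq) = _ , P , β , eq

  toFromW : ∀ {s l′} (P : Path (W (2+ s) l′)) → toW (fromW P) ≡ P
  toFromW (P ▷ E2 β eq) = refl

  enum≡ : (m n : ℕ) → Enumeration (m ≡ n)
  enum≡ m n = enumDec ≡-irrelevant (m ≟ n)

  paths-S : ∀ i → Enumeration (Path (S i))
  paths-S i = record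
    { elements = [ start i ] ; unique = [] ∷ [] ; complete = λ { (start _) → here refl } }

  paths-V : ∀ s .{{_ : NonZero s}} l → Enumeration (Path (V s l))
  paths-W : ∀ s .{{_ : NonTrivial s}} l′ → Enumeration (Path (W s l′))

  paths-V 1 l = enumMap toV₁ fromV₁ (λ _ → refl) toFromV₁
    (enumΣ (λ i → enumΣ (λ t → enum≡ _ _) (enumFin _)) (enumFin _))
  paths-V (2+ s) l = enumMap toV₂ fromV₂ (λ _ → refl) toFromV₂
    (enumΣ (λ l′ → enumΣ (λ _ → enum≡ _ _) (paths-W (2+ s) l′)) (enumFin _))

  paths-W (2+ s) l′ = enumMap toW fromW (λ _ → refl) toFromW
    (enumΣ (λ l → enumΣ (λ _ → enumΣ (λ β → enum≡ _ _) (enumFin _)) (paths-V (suc s) l)) (enumFin _))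

  paths : ∀ v → Enumeration (Path v)
  paths (S i)   = paths-S i
  paths (V s l) = paths-V s l
  paths (W s l) = paths-W s l

  𝓜 : Vertex → ℕ
  𝓜 v = sumOver (paths v) des

{-# OPTIONS --safe #-}
module Submission where

-- For k = 1 the edge V_b → W_{l′} → V_c forces l′ = p b + c, so a path to V_{s,t} is a free choice of
-- t₀ < p - 1 and of digits l₁, …, l_{s-1} < p, followed by l_s = t.  All blocks from B³ on have p (p - 1)
-- nodes, so a descent is a single inequality on two or three consecutive digits, and each such inequality
-- is a lexicographic comparison.  With q = (p - 1) / 2, counting the digits gives
--   𝓜(V_{s+3,c}) = Σ_b 𝓜(V_{s+2,b}) + (p - 1) p^s (p q + c + p (q + [c < q])),
-- and the closed form follows by induction on s.

open import Defs
open import Data.Bool.Base using (true; false; if_then_else_)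
open import Data.Fin.Base using (Fin; zero; suc; toℕ; cast; fromℕ<)
open import Data.Fin.Properties using (toℕ<n; toℕ-cast; toℕ-fromℕ<; toℕ-injective)
open import Data.Integer.Base as ℤ using (+_)
import Data.Integer.Properties as ℤ
open import Data.List.Base using (List; []; _∷_; [_]; _++_; map; length; filter; upTo)
open import Data.List.Membership.Propositional.Properties.WithK using (unique∧set⇒bag)
open import Data.List.Properties using (map-∘; map-cong; map-++; map-tabulate; length-++; filter-++; upTo-∷ʳ)
open import Data.List.Relation.Binary.BagAndSetEquality using (∼bag⇒↭)
import Data.List.Relation.Binary.Permutation.Propositional.Properties as ↭
open import Data.List.Relation.Unary.All using (All; []; _∷_)
open import Data.List.Relation.Unary.All.Properties using (all-upTo)
import Data.List.Relation.Unary.All as All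
open import Data.Nat.Base using (ℕ; zero; suc; 2+; NonZero; _+_; _*_; _∸_; _^_; _≤_; _<_; z≤n; s≤s)
open import Data.Nat.Divisibility using (_∣_; divides; m∣m*n)
open import Data.Nat.DivMod using (_/_; m≡m%n+[m/n]*n; m%n<n; m*n/n≡m; /-congˡ; m<n⇒m/n≡0; +-distrib-/-∣ˡ)
open import Data.Nat.ListAction using (sum)
open import Data.Nat.ListAction.Properties using (sum-++; sum-↭)
open import Data.Nat.Primality using (Prime)
open import Data.Nat.Properties
open import Data.Nat.Tactic.RingSolver using (solve-∀)
open import Data.Product.Base using (Σ; Σ-syntax; _×_; _,_)
open import Data.Sum.Base using (_⊎_; inj₁; inj₂)
open import Function.Base using (_∘_; id)
open import Function.Bundles using (_⇔_; mk⇔; Equivalence)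
open import Function.Construct.Composition using (_⇔-∘_)
open import Relation.Binary.PropositionalEquality using (_≡_; refl; sym; trans; cong; cong₂; subst; module ≡-Reasoning)
open import Relation.Nullary using (¬_; Dec; does; yes; no; contradiction)
open import Relation.Nullary.Decidable using (does-⇔; dec-true; dec-false)
open import Relation.Unary using (Decidable)

private
  variable
    A C : Set

-- Iverson brackets and sums over enumerations.

⟦_⟧ : Dec A → ℕ
⟦ A? ⟧ = if does A? then 1 else 0

⟦⟧-cong : (A? : Dec A) (C? : Dec C) → A ⇔ C → ⟦ A? ⟧ ≡ ⟦ C? ⟧
⟦⟧-cong A? C? A⇔C = cong (if_then 1 else 0) (does-⇔ A⇔C A? C?)

⟦⟧-yes : (A? : Dec A) → A → ⟦ A? ⟧ ≡ 1
⟦⟧-yes A? a = cong (if_then 1 else 0) (dec-true A? a)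

⟦⟧-no : (A? : Dec A) → ¬ A → ⟦ A? ⟧ ≡ 0
⟦⟧-no A? ¬a = cong (if_then 1 else 0) (dec-false A? ¬a)

length-filter-[] : {P : A → Set} (P? : Decidable P) (x : A) → length (filter P? [ x ]) ≡ ⟦ P? x ⟧
length-filter-[] P? x with does (P? x)
... | true  = refl
... | false = refl

length-filter-cong : {P Q : A → Set} (P? : Decidable P) (Q? : Decidable Q) {xs : List A} →
                     All (λ x → P x ⇔ Q x) xs → length (filter P? xs) ≡ length (filter Q? xs)
length-filter-cong P? Q? [] = refl
length-filter-cong P? Q? {x ∷ xs} (P⇔Q ∷ eqs)
  with does (P? x) | does (Q? x) | does-⇔ P⇔Q (P? x) (Q? x)
... | true  | .true  | refl = cong suc (length-filter-cong P? Q? eqs)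
... | false | .false | refl = length-filter-cong P? Q? eqs

sum-map-+ : (f g : A → ℕ) (xs : List A) →
            sum (map (λ x → f x + g x) xs) ≡ sum (map f xs) + sum (map g xs)
sum-map-+ f g [] = refl
sum-map-+ f g (x ∷ xs) =
  trans (cong (_+_ (f x + g x)) (sum-map-+ f g xs)) (interchange (f x) (g x) _ _)
  where
  interchange : ∀ a b c d → a + b + (c + d) ≡ a + c + (b + d)
  interchange = solve-∀

sum-map-*ˡ : (k : ℕ) (f : A → ℕ) (xs : List A) → sum (map (λ x → k * f x) xs) ≡ k * sum (map f xs)
sum-map-*ˡ k f [] = sym (*-zeroʳ k)
sum-map-*ˡ k f (x ∷ xs) =
  trans (cong (_+_ (k * f x)) (sum-map-*ˡ k f xs)) (sym (*-distribˡ-+ k (f x) _))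

sumOver-cong : (xs : Enumeration A) {f g : A → ℕ} → (∀ x → f x ≡ g x) → sumOver xs f ≡ sumOver xs g
sumOver-cong xs eq = cong sum (map-cong eq (elements xs))

sumOver-+ : (xs : Enumeration A) (f g : A → ℕ) →
            sumOver xs (λ x → f x + g x) ≡ sumOver xs f + sumOver xs g
sumOver-+ xs f g = sum-map-+ f g (elements xs)

sumOver-*ˡ : (xs : Enumeration A) (k : ℕ) (f : A → ℕ) →
             sumOver xs (λ x → k * f x) ≡ k * sumOver xs f
sumOver-*ˡ xs k f = sum-map-*ˡ k f (elements xs)

sumOver-const : (xs : Enumeration A) (k : ℕ) → sumOver xs (λ _ → k) ≡ k * sumOver xs (λ _ → 1)
sumOver-const xs k = trans (sumOver-cong xs (λ _ → sym (*-identityʳ k))) (sumOver-*ˡ xs k (λ _ → 1))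

-- Two duplicate-free complete lists of the same type are permutations of each other. Paths may
-- therefore be summed along any convenient enumeration instead of the one that defines `𝓜`.
sumOver-unique : (xs ys : Enumeration A) (f : A → ℕ) → sumOver xs f ≡ sumOver ys f
sumOver-unique xs ys f = sum-↭ (↭.map⁺ f (∼bag⇒↭ (unique∧set⇒bag (unique xs) (unique ys)
  (mk⇔ (λ _ → complete ys _) (λ _ → complete xs _)))))

sumOver-enumΣ : {F : A → Set} (ys : ∀ a → Enumeration (F a)) (xs : Enumeration A) (f : Σ A F → ℕ) →
                sumOver (enumΣ ys xs) f ≡ sumOver xs (λ a → sumOver (ys a) (λ b → f (a , b)))
sumOver-enumΣ ys xs f = go (elements xs)
  where
  open ≡-Reasoning
  go : ∀ as → sum (map f (pairs ys as)) ≡ sum (map (λ a → sumOver (ys a) (λ b → f (a , b))) as)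
  go [] = refl
  go (a ∷ as) = begin
    sum (map f (map (a ,_) (elements (ys a)) ++ pairs ys as))
      ≡⟨ cong sum (map-++ f (map (a ,_) (elements (ys a))) _) ⟩
    sum (map f (map (a ,_) (elements (ys a))) ++ map f (pairs ys as))
      ≡⟨ sum-++ (map f (map (a ,_) (elements (ys a)))) _ ⟩
    sum (map f (map (a ,_) (elements (ys a)))) + sum (map f (pairs ys as))
      ≡⟨ cong₂ _+_ (cong sum (sym (map-∘ (elements (ys a))))) (go as) ⟩
    sumOver (ys a) (λ b → f (a , b)) + sum (map (λ a → sumOver (ys a) (λ b → f (a , b))) as) ∎

sumOver-enumMap : (f : A → C) (g : C → A) (gf : ∀ a → g (f a) ≡ a) (fg : ∀ c → f (g c) ≡ c)
                  (xs : Enumeration A) (h : C → ℕ) → sumOver (enumMap f g gf fg xs) h ≡ sumOver xs (h ∘ f)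
sumOver-enumMap f g gf fg xs h = cong sum (sym (map-∘ (elements xs)))

-- Sums over initial segments of the natural numbers.

∑ : (n : ℕ) → (ℕ → ℕ) → ℕ
∑ n f = sumOver (enumFin n) (f ∘ toℕ)

∑-suc : ∀ n f → ∑ (suc n) f ≡ f 0 + ∑ n (f ∘ suc)
∑-suc n f = cong (λ xs → f 0 + sum xs)
  (trans (map-tabulate {n = n} suc (f ∘ toℕ)) (sym (map-tabulate {n = n} id (f ∘ suc ∘ toℕ))))

∑-1 : ∀ n → ∑ n (λ _ → 1) ≡ n
∑-1 zero    = refl
∑-1 (suc n) = trans (∑-suc n (λ _ → 1)) (cong suc (∑-1 n))

∑-const : ∀ n k → ∑ n (λ _ → k) ≡ n * k
∑-const n k = trans (sumOver-const (enumFin n) k) (trans (cong (k *_) (∑-1 n)) (*-comm k n))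

∑-⟦<⟧ : ∀ {n r} → r ≤ n → ∑ n (λ i → ⟦ i <? r ⟧) ≡ r
∑-⟦<⟧ {zero}  {zero}  _         = refl
∑-⟦<⟧ {suc n} {zero}  _         = trans (∑-suc n (λ i → ⟦ i <? 0 ⟧)) (∑-⟦<⟧ {n} z≤n)
∑-⟦<⟧ {suc n} {suc r} (s≤s r≤n) = trans (∑-suc n (λ i → ⟦ i <? suc r ⟧)) (cong suc
  (trans (sumOver-cong (enumFin n) (λ i → ⟦⟧-cong (suc (toℕ i) <? suc r) (toℕ i <? r) (mk⇔ (λ { (s≤s i<r) → i<r }) s≤s)))
         (∑-⟦<⟧ r≤n)))

-- The condition selects the last `r` indices; the additive form avoids the truncated `n ∸ r`.
∑-⟦≤+⟧ : ∀ n r → r ≤ n → ∑ n (λ i → ⟦ n ≤? i + r ⟧) ≡ r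
∑-⟦≤+⟧ zero    .zero z≤n = refl
∑-⟦≤+⟧ (suc n) r r≤1+n = begin
  ∑ (suc n) (λ i → ⟦ suc n ≤? i + r ⟧)
    ≡⟨ ∑-suc n (λ i → ⟦ suc n ≤? i + r ⟧) ⟩
  ⟦ suc n ≤? r ⟧ + ∑ n (λ i → ⟦ suc n ≤? suc i + r ⟧)
    ≡⟨ cong (_+_ ⟦ suc n ≤? r ⟧) (sumOver-cong (enumFin n) λ i →
         ⟦⟧-cong (suc n ≤? suc (toℕ i) + r) (n ≤? toℕ i + r) (mk⇔ (λ { (s≤s le) → le }) s≤s)) ⟩
  ⟦ suc n ≤? r ⟧ + ∑ n (λ i → ⟦ n ≤? i + r ⟧)
    ≡⟨ rest (m≤n⇒m<n∨m≡n r≤1+n) ⟩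
  r ∎
  where
  open ≡-Reasoning
  rest : r < suc n ⊎ r ≡ suc n → ⟦ suc n ≤? r ⟧ + ∑ n (λ i → ⟦ n ≤? i + r ⟧) ≡ r
  rest (inj₁ r<1+n@(s≤s r≤n)) = cong₂ _+_ (⟦⟧-no (suc n ≤? r) (<⇒≱ r<1+n)) (∑-⟦≤+⟧ n r r≤n)
  rest (inj₂ refl) = cong₂ _+_ (⟦⟧-yes (suc n ≤? suc n) ≤-refl)
    (trans (sumOver-cong (enumFin n) λ i → ⟦⟧-yes (n ≤? toℕ i + suc n) (≤-trans (n≤1+n n) (m≤n+m (suc n) (toℕ i))))
           (∑-1 n))

∑-id : ∀ n → ∑ (suc n) id * 2 ≡ suc n * n
∑-id zero    = refl
∑-id (suc n) = begin
  ∑ (2+ n) id * 2                              ≡⟨ cong (_* 2) (∑-suc (suc n) id) ⟩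
  ∑ (suc n) (λ i → 1 + i) * 2                  ≡⟨ cong (_* 2) (sumOver-+ (enumFin (suc n)) (λ _ → 1) toℕ) ⟩
  (∑ (suc n) (λ _ → 1) + ∑ (suc n) id) * 2     ≡⟨ cong (λ z → (z + ∑ (suc n) id) * 2) (∑-1 (suc n)) ⟩
  (suc n + ∑ (suc n) id) * 2                   ≡⟨ *-distribʳ-+ 2 (suc n) _ ⟩
  suc n * 2 + ∑ (suc n) id * 2                 ≡⟨ cong (_+_ (suc n * 2)) (∑-id n) ⟩
  suc n * 2 + suc n * n                        ≡⟨ factor n ⟩
  2+ n * suc n                                 ∎
  where
  open ≡-Reasoning
  factor : ∀ n → (1 + n) * 2 + (1 + n) * n ≡ (2 + n) * (1 + n)
  factor = solve-∀

-- Lexicographic comparison and the counts of digits.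

-- The trailing parts are too small to outweigh a difference in the leading digits, so they only
-- decide the tie `a ≡ b`. The bracket admits that tie exactly when `c < d`, which leaves one bound
-- on `a`.
lexicographic : ∀ {k c d} a b → c < k → d ≤ k → (k * a + c < k * b + d) ⇔ (a < b + ⟦ c <? d ⟧)
lexicographic {k} {c} {d} a b c<k d≤k with c <? d
... | yes c<d rewrite ⟦⟧-yes (c <? d) c<d = mk⇔ to from
  where
  open ≤-Reasoning
  to : k * a + c < k * b + d → a < b + 1
  to lt = ≰⇒> λ b+1≤a → <⇒≱ lt (begin
    k * b + d      ≤⟨ +-monoʳ-≤ (k * b) d≤k ⟩
    k * b + k      ≡⟨ +-comm (k * b) k ⟩
    k + k * b      ≡⟨ *-suc k b ⟨
    k * suc b      ≤⟨ *-monoʳ-≤ k (subst (_≤ a) (+-comm b 1) b+1≤a) ⟩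
    k * a          ≤⟨ m≤m+n (k * a) c ⟩
    k * a + c      ∎)
  from : a < b + 1 → k * a + c < k * b + d
  from a<b+1 = +-mono-≤-< (*-monoʳ-≤ k (<⇒≤pred (subst (a <_) (+-comm b 1) a<b+1))) c<d
... | no c≮d rewrite ⟦⟧-no (c <? d) c≮d = mk⇔ to from
  where
  open ≤-Reasoning
  to : k * a + c < k * b + d → a < b + 0
  to lt = ≰⇒> λ b≤a → <⇒≱ lt (+-mono-≤ (*-monoʳ-≤ k (subst (_≤ a) (+-identityʳ b) b≤a)) (≮⇒≥ c≮d))
  from : a < b + 0 → k * a + c < k * b + d
  from a<b = begin-strict
    k * a + c      <⟨ +-monoʳ-< (k * a) c<k ⟩
    k * a + k      ≡⟨ +-comm (k * a) k ⟩
    k + k * a      ≡⟨ *-suc k a ⟨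
    k * suc a      ≤⟨ *-monoʳ-≤ k (subst (a <_) (+-identityʳ b) a<b) ⟩
    k * b          ≤⟨ m≤m+n (k * b) d ⟩
    k * b + d      ∎

⟦⟧≤1 : (A? : Dec A) → ⟦ A? ⟧ ≤ 1
⟦⟧≤1 A? with does A?
... | true  = ≤-refl
... | false = z≤n

-- Indicators of the two kinds of descent, for consecutive digits a, b, c: δ₁ compares the blocks
-- of V_b → W → V_c with each other, δ₂ the last block into V_b (coming from V_a) with the first block out of it.
δ₁ : ℕ → ℕ → ℕ → ℕ
δ₁ p b c = ⟦ (p ∸ 1) * b + c + p * b <? p * (p ∸ 1) ⟧

δ₂ : ℕ → ℕ → ℕ → ℕ → ℕ
δ₂ p a b c = ⟦ p * (p ∸ 1) <? p * a + ((p ∸ 1) * b + c) ⟧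

-- With p = 2q + 1 the inequality behind `δ₁` reads (4q + 1) b + c < (4q + 1) q + q, a lexicographic
-- comparison of (b, c) with (q, q).
∑-δ₁ : ∀ {p q c} → p ≡ suc (2 * q) → c < p → ∑ p (λ b → δ₁ p b c) ≡ q + ⟦ c <? q ⟧
∑-δ₁ {p} {q} {c} refl c<p = trans
  (sumOver-cong (enumFin p) λ b → ⟦⟧-cong ((p ∸ 1) * toℕ b + c + p * toℕ b <? p * (p ∸ 1)) (toℕ b <? q + ⟦ c <? q ⟧) (equiv (toℕ b)))
  (∑-⟦<⟧ bound)
  where
  left : ∀ q b c → 2 * q * b + c + (1 + 2 * q) * b ≡ (1 + 4 * q) * b + c
  left = solve-∀
  right : ∀ q → (1 + 2 * q) * (2 * q) ≡ (1 + 4 * q) * q + q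
  right = solve-∀
  double : ∀ q → 4 * q ≡ 2 * q + 2 * q
  double = solve-∀
  p≤k : suc (2 * q) ≤ suc (4 * q)
  p≤k = s≤s (subst (2 * q ≤_) (sym (double q)) (m≤m+n (2 * q) (2 * q)))
  equiv : ∀ b → (2 * q * b + c + suc (2 * q) * b < suc (2 * q) * (2 * q)) ⇔ (b < q + ⟦ c <? q ⟧)
  equiv b rewrite left q b c | right q =
    lexicographic b q (<-≤-trans c<p p≤k) (m≤n⇒m≤1+n (m≤n*m q 4))
  bound : q + ⟦ c <? q ⟧ ≤ suc (2 * q)
  bound = subst (q + ⟦ c <? q ⟧ ≤_) (+-comm (2 * q) 1) (+-mono-≤ (m≤n*m q 2) (⟦⟧≤1 (c <? q)))

∑-id-odd : ∀ {p q} → p ≡ suc (2 * q) → ∑ p id ≡ p * q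
∑-id-odd {q = q} refl = *-cancelʳ-≡ _ _ 2 (trans (∑-id (2 * q)) (assoc q))
  where
  assoc : ∀ q → (1 + 2 * q) * (2 * q) ≡ (1 + 2 * q) * q * 2
  assoc = solve-∀

-- Here p is `suc r`. Adding b to both sides turns the inequality into p r + b < p (a + b) + c,
-- which compares (r, b) with (a + b, c) lexicographically and so bounds a from below.
∑-δ₂ : ∀ {r b c} → b < suc r → c < suc r → ∑ (suc r) (λ a → δ₂ (suc r) a b c) ≡ b + ⟦ b <? c ⟧
∑-δ₂ {r} {b} {c} b<p c<p = trans
  (sumOver-cong (enumFin (suc r)) λ a → ⟦⟧-cong (suc r * r <? suc r * toℕ a + (r * b + c)) (suc r ≤? toℕ a + (b + ⟦ b <? c ⟧)) (equiv (toℕ a)))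
  (∑-⟦≤+⟧ (suc r) (b + ⟦ b <? c ⟧) (subst (b + ⟦ b <? c ⟧ ≤_) (+-comm r 1) (+-mono-≤ (<⇒≤pred b<p) (⟦⟧≤1 (b <? c)))))
  where
  shift : ∀ r a b c → (1 + r) * a + (r * b + c) + b ≡ (1 + r) * (a + b) + c
  shift = solve-∀
  equiv : ∀ a → (suc r * r < suc r * a + (r * b + c)) ⇔ (suc r ≤ a + (b + ⟦ b <? c ⟧))
  equiv a = mk⇔
    (λ lt → subst (r <_) (+-assoc a b _) (Equivalence.to lex (subst (suc r * r + b <_) (shift r a b c) (+-monoˡ-< b lt))))
    (λ lt → +-cancelʳ-< b _ _ (subst (suc r * r + b <_) (sym (shift r a b c)) (Equivalence.from lex (subst (r <_) (sym (+-assoc a b _)) lt))))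
    where
    lex = lexicographic {suc r} {b} {c} r (a + b) b<p (<⇒≤ c<p)

∑-carry : ∀ {n c} → c ≤ n → ∑ n (λ b → b + ⟦ b <? c ⟧) ≡ ∑ n id + c
∑-carry {n} {c} c≤n = trans (sumOver-+ (enumFin n) toℕ (λ b → ⟦ toℕ b <? c ⟧)) (cong (_+_ (∑ n id)) (∑-⟦<⟧ c≤n))

quotient-unique : ∀ n .{{_ : NonZero n}} {m b r} → m ≡ n * b + r → r < n → m / n ≡ b
quotient-unique n {b = b} {r} refl r<n = begin
  (n * b + r) / n     ≡⟨ +-distrib-/-∣ˡ r (m∣m*n b) ⟩
  n * b / n + r / n   ≡⟨ cong₂ _+_ (trans (/-congˡ (*-comm n b)) (m*n/n≡m b n)) (m<n⇒m/n≡0 r<n) ⟩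
  b + 0               ≡⟨ +-identityʳ b ⟩
  b                   ∎
  where open ≡-Reasoning

-- Descents of a path extended by one edge, for arbitrary k.

module Descents (p : ℕ) (p-prime : Prime p) (p-odd : ¬ 2 ∣ p) (k : ℕ) where

  open Column p p-prime p-odd k

  block-new : ∀ {v w} (P : Path v) (e : Edge v w) → block (P ▷ e) (suc (top P)) ≡ label e
  block-new P e with suc (top P) ≟ suc (top P)
  ... | yes _  = refl
  ... | no  ≢ = contradiction refl ≢

  block-old : ∀ {v w j} (P : Path v) (e : Edge v w) → j ≤ top P → block (P ▷ e) j ≡ block P j
  block-old {j = j} P e j≤ with j ≟ suc (top P)
  ... | yes refl = contradiction j≤ (<⇒≱ ≤-refl)
  ... | no  _    = refl

  -- For j ≥ 3 the test reads blocks j and j + 1, and for j = 1 it reads block 2; all of these lie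
  -- in `P` already when `j < top P`.
  IsDescent-old : ∀ {v w j} (P : Path v) (e : Edge v w) → j < top P → IsDescent (P ▷ e) j ⇔ IsDescent P j
  IsDescent-old {j = 0} P e j< = mk⇔ id id
  IsDescent-old {j = 1} P e j< rewrite block-old P e j< = mk⇔ id id
  IsDescent-old {j = 2} P e j< = mk⇔ id id
  IsDescent-old {j = suc (suc (suc j))} P e j<
    rewrite block-old P e j< | block-old P e (<⇒≤ j<) = mk⇔ id id

  -- The new edge adds the single index `top P` to the range tested and leaves the earlier tests
  -- unchanged.
  des-▷ : ∀ {v w} (P : Path v) (e : Edge v w) → des (P ▷ e) ≡ des P + ⟦ isDescent? (P ▷ e) (top P) ⟧
  des-▷ P e = begin
    length (filter D? (upTo (suc (top P))))
      ≡⟨ cong (length ∘ filter D?) (upTo-∷ʳ (top P)) ⟨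
    length (filter D? (upTo (top P) ++ [ top P ]))
      ≡⟨ cong length (filter-++ D? (upTo (top P)) [ top P ]) ⟩
    length (filter D? (upTo (top P)) ++ filter D? [ top P ])
      ≡⟨ length-++ (filter D? (upTo (top P))) ⟩
    length (filter D? (upTo (top P))) + length (filter D? [ top P ])
      ≡⟨ cong₂ _+_ (length-filter-cong D? (isDescent? P) (All.map (IsDescent-old P e) (all-upTo (top P))))
                   (length-filter-[] D? (top P)) ⟩
    des P + ⟦ D? (top P) ⟧ ∎
    where
    open ≡-Reasoning
    D? = isDescent? (P ▷ e)

  top≥1 : ∀ {v} (P : Path v) → 1 ≤ top P
  top≥1 (start _) = ≤-refl
  top≥1 (P ▷ _)   = s≤s z≤n

  _≻_ : Block → Block → Set
  b ≻ b′ = horizontal b′ < horizontal b × vertical b < vertical b′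

  IsDescent-≥3 : ∀ {v j} (P : Path v) → 3 ≤ j → IsDescent P j ⇔ (block P j ≻ block P (suc j))
  IsDescent-≥3 P (s≤s (s≤s (s≤s z≤n))) = mk⇔ id id

  last : ∀ {v} → Path v → Block
  last P = block P (top P)

  IsDescent-top : ∀ {v w b b′} (P : Path v) (e : Edge v w) → 3 ≤ top P →
                  last P ≡ b → label e ≡ b′ → IsDescent (P ▷ e) (top P) ⇔ (b ≻ b′)
  IsDescent-top P e 3≤ refl refl with IsDescent-≥3 (P ▷ e) 3≤
  ... | eq rewrite block-old P e (≤-refl {top P}) | block-new P e = eq

  -- For blocks with equally many nodes either inequality of `_≻_` implies the other. The two forms
  -- differ in which components survive: `≻⇔lower` keeps `n` and `m′`, `≻⇔upper` keeps `m` and `n′`,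
  -- so that in each application the components given by truncated subtraction drop out.
  module _ {m n m′ n′ c : ℕ} (m+n≡c : m + n ≡ c) (m′+n′≡c : m′ + n′ ≡ c) where

    private
      <⇒> : m′ < m → n < n′
      <⇒> m′<m = ≰⇒> λ n′≤n → <⇒≢ (+-mono-<-≤ m′<m n′≤n) (trans m′+n′≡c (sym m+n≡c))

    ≻⇔lower : (B m n ≻ B m′ n′) ⇔ (n + m′ < c)
    ≻⇔lower = mk⇔
      (λ (m′<m , _) → subst (n + m′ <_) (trans (+-comm n m) m+n≡c) (+-monoʳ-< n m′<m))
      (λ lt → let m′<m = +-cancelˡ-< n _ _ (subst (n + m′ <_) (trans (sym m+n≡c) (+-comm m n)) lt) in m′<m , <⇒> m′<m)

    ≻⇔upper : (B m n ≻ B m′ n′) ⇔ (c < m + n′)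
    ≻⇔upper = mk⇔
      (λ (m′<m , _) → subst (_< m + n′) m′+n′≡c (+-monoˡ-< n′ m′<m))
      (λ lt → let m′<m = +-cancelʳ-< n′ _ _ (subst (_< m + n′) (sym m′+n′≡c) lt) in m′<m , <⇒> m′<m)

-- The case k = 1: paths as strings of digits.

module FirstColumn (p : ℕ) (p-prime : Prime p) (p-odd : ¬ 2 ∣ p) where

  open Column p p-prime p-odd 1
  open Descents p p-prime p-odd 1

  q : ℕ
  q = (p ∸ 1) / 2

  p≡1+2q : p ≡ suc (2 * q)
  p≡1+2q = trans p≡1+2h (cong (λ z → suc (2 * z)) (sym q≡h))
    where
    h = p / 2
    remainder : ∀ {r} → p ≡ r + h * 2 → r < 2 → p ≡ 1 + h * 2
    remainder {0} eq _ = contradiction (divides h eq) p-odd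
    remainder {1} eq _ = eq
    remainder {2+ _} _ (s≤s (s≤s ()))
    p≡1+2h : p ≡ suc (2 * h)
    p≡1+2h = trans (remainder (m≡m%n+[m/n]*n p 2) (m%n<n p 2)) (cong suc (*-comm h 2))
    q≡h : q ≡ h
    q≡h = trans (/-congˡ (trans (cong (_∸ 1) p≡1+2h) (*-comm 2 h))) (m*n/n≡m h 2)

  p≡1+[p∸1] : p ≡ suc (p ∸ 1)
  p≡1+[p∸1] = trans p≡1+2q (cong suc (sym (cong (_∸ 1) p≡1+2q)))

  toℕ<p : (l : Fin (p ^ 1)) → toℕ l < p
  toℕ<p l = subst (toℕ l <_) (^-identityʳ p) (toℕ<n l)

  toℕ≤p∸1 : (l : Fin (p ^ 1)) → toℕ l ≤ p ∸ 1
  toℕ≤p∸1 l = ∸-monoˡ-≤ 1 (toℕ<p l)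

  ∑-p^1 : ∀ f → ∑ (p ^ 1) f ≡ ∑ p f
  ∑-p^1 f = cong (λ n → ∑ n f) (^-identityʳ p)

  -- The parameter t of the edge leaving W is the digit b of the V-vertex before it, because β < p.
  E2-quotient : ∀ {l′ : Fin (p ^ 2)} {b : Fin (p ^ 1)} (β : Fin p) →
                toℕ l′ ≡ p * toℕ b + toℕ β → toℕ l′ / p ^ 1 ≡ toℕ b
  E2-quotient {l′} {b} β eq = quotient-unique (p ^ 1)
    (trans eq (cong (λ z → z * toℕ b + toℕ β) (sym (^-identityʳ p))))
    (subst (toℕ β <_) (sym (^-identityʳ p)) (toℕ<n β))

  E2-remainder : ∀ {l′ : Fin (p ^ 2)} {b : Fin (p ^ 1)} (β : Fin p) →
                 toℕ l′ ≡ p * toℕ b + toℕ β → toℕ l′ ∸ p ^ 1 * (toℕ l′ / p ^ 1) ≡ toℕ β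
  E2-remainder {l′} {b} β eq = trans
    (cong₂ _∸_ eq (cong₂ _*_ (^-identityʳ p) (E2-quotient {l′} {b} β eq)))
    (m+n∸m≡n (p * toℕ b) (toℕ β))

  digits<p² : (b c : Fin (p ^ 1)) → p * toℕ b + toℕ c < p ^ 2
  digits<p² b c = begin-strict
    p * toℕ b + toℕ c  <⟨ +-monoʳ-< (p * toℕ b) (toℕ<p c) ⟩
    p * toℕ b + p      ≡⟨ +-comm (p * toℕ b) p ⟩
    p + p * toℕ b      ≡⟨ *-suc p (toℕ b) ⟨
    p * suc (toℕ b)    ≤⟨ *-monoʳ-≤ p (toℕ<n b) ⟩
    p ^ 2              ∎
    where open ≤-Reasoning

  digits : Fin (p ^ 1) → Fin (p ^ 1) → Fin (p ^ 2)
  digits b c = fromℕ< (digits<p² b c)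

  digit : Fin (p ^ 1) → Fin p
  digit = cast (^-identityʳ p)

  toℕ-digits : ∀ b c → toℕ (digits b c) ≡ p * toℕ b + toℕ (digit c)
  toℕ-digits b c = trans (toℕ-fromℕ< (digits<p² b c)) (cong (_+_ (p * toℕ b)) (sym (toℕ-cast (^-identityʳ p) c)))

  up : ∀ s b c → Edge (V (suc s) b) (W (2+ s) (digits b c))
  up s b c = E2 (digit c) (toℕ-digits b c)

  down : ∀ s b c → Edge (W (2+ s) (digits b c)) (V (2+ s) c)
  down s b c = E3 (sym (trans (E2-remainder {digits b c} {b} (digit c) (toℕ-digits b c)) (toℕ-cast (^-identityʳ p) c)))

  extend : ∀ {s} c → Σ[ b ∈ Fin (p ^ 1) ] Path (V (suc s) b) → Path (V (2+ s) c)
  extend {s} c (b , P) = P ▷ up s b c ▷ down s b c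

  truncate : ∀ {s c} → Path (V (2+ s) c) → Σ[ b ∈ Fin (p ^ 1) ] Path (V (suc s) b)
  truncate (P ▷ E2 _ _ ▷ E3 _) = _ , P

  -- The edge into V_c makes c the remainder of l′ modulo p, hence β = c and l′ = p b + c. The last
  -- two edges are thus determined by b and c.
  extend-truncate : ∀ {s c} (P : Path (V (2+ s) c)) → extend c (truncate P) ≡ P
  extend-truncate {s} {c} (_▷_ {v = W _ l′} (_▷_ {v = V _ b} P (E2 β eq)) (E3 eq′)) =
    unique-step l′≡ β≡
    where
    c≡β : toℕ c ≡ toℕ β
    c≡β = trans eq′ (E2-remainder {l′} {b} β eq)
    β≡ : digit c ≡ β
    β≡ = toℕ-injective (trans (toℕ-cast (^-identityʳ p) c) c≡β)
    l′≡ : digits b c ≡ l′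
    l′≡ = toℕ-injective (trans (toℕ-fromℕ< (digits<p² b c)) (trans (cong (_+_ (p * toℕ b)) c≡β) (sym eq)))
    -- With the indices generalised to variables both equations can be matched; what then differs is
    -- two proofs of equations between naturals, and such proofs are unique.
    unique-step : ∀ {l₁ l₂ β₁ β₂} {e₁ : toℕ l₁ ≡ p * toℕ b + toℕ β₁} {e₂ : toℕ l₂ ≡ p * toℕ b + toℕ β₂}
                  {e₁′ : toℕ c ≡ toℕ l₁ ∸ p ^ 1 * (toℕ l₁ / p ^ 1)} {e₂′ : toℕ c ≡ toℕ l₂ ∸ p ^ 1 * (toℕ l₂ / p ^ 1)} →
                  l₁ ≡ l₂ → β₁ ≡ β₂ →
                  _≡_ {A = Path (V (2+ s) c)} (P ▷ E2 β₁ e₁ ▷ E3 e₁′) (P ▷ E2 β₂ e₂ ▷ E3 e₂′)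
    unique-step {l₁} {β₁ = β₁} refl refl = cong₂ (λ e e′ → P ▷ E2 {l′ = l₁} β₁ e ▷ E3 e′) (≡-irrelevant _ _) (≡-irrelevant _ _)

  -- `extend` and `truncate` are mutually inverse, so a sum over paths to V_c becomes a free sum
  -- over the preceding digit b and the paths to V_b.
  sumOver-extend : ∀ s c (f : Path (V (2+ s) c) → ℕ) →
    sumOver (paths-V (2+ s) c) f ≡
    sumOver (enumFin (p ^ 1)) (λ b → sumOver (paths-V (suc s) b) (λ P → f (extend c (b , P))))
  sumOver-extend s c f = begin
    sumOver (paths-V (2+ s) c) f
      ≡⟨ sumOver-unique (paths-V (2+ s) c) (enumMap (extend c) truncate (λ _ → refl) extend-truncate pairs′) f ⟩
    sumOver (enumMap (extend c) truncate (λ _ → refl) extend-truncate pairs′) f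
      ≡⟨ sumOver-enumMap (extend c) truncate (λ _ → refl) extend-truncate pairs′ f ⟩
    sumOver pairs′ (f ∘ extend c)
      ≡⟨ sumOver-enumΣ (paths-V (suc s)) (enumFin (p ^ 1)) (f ∘ extend c) ⟩
    sumOver (enumFin (p ^ 1)) (λ b → sumOver (paths-V (suc s) b) (λ P → f (extend c (b , P)))) ∎
    where
    open ≡-Reasoning
    pairs′ = enumΣ (paths-V (suc s)) (enumFin (p ^ 1))

  origin< : (c : Fin (p ^ 1)) (t : Fin (p ∸ 1)) → p ^ 1 * toℕ t + toℕ c < p ^ 1 * (p ∸ 1)
  origin< c t = begin-strict
    p ^ 1 * toℕ t + toℕ c  <⟨ +-monoʳ-< (p ^ 1 * toℕ t) (toℕ<n c) ⟩
    p ^ 1 * toℕ t + p ^ 1  ≡⟨ +-comm (p ^ 1 * toℕ t) (p ^ 1) ⟩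
    p ^ 1 + p ^ 1 * toℕ t  ≡⟨ *-suc (p ^ 1) (toℕ t) ⟨
    p ^ 1 * suc (toℕ t)    ≤⟨ *-monoʳ-≤ (p ^ 1) (toℕ<n t) ⟩
    p ^ 1 * (p ∸ 1)        ∎
    where open ≤-Reasoning

  initial : ∀ c → Fin (p ∸ 1) → Path (V 1 c)
  initial c t = start (fromℕ< (origin< c t)) ▷ E1 t (toℕ-fromℕ< (origin< c t))

  initial⁻¹ : ∀ {c} → Path (V 1 c) → Fin (p ∸ 1)
  initial⁻¹ (start _ ▷ E1 t _) = t

  initial-initial⁻¹ : ∀ {c} (P : Path (V 1 c)) → initial c (initial⁻¹ P) ≡ P
  initial-initial⁻¹ {c} (start i ▷ E1 t eq) =
    unique-start (toℕ-injective (trans (toℕ-fromℕ< (origin< c t)) (sym eq)))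
    where
    unique-start : ∀ {i₁ i₂} {e₁ : toℕ i₁ ≡ p ^ 1 * toℕ t + toℕ c} {e₂ : toℕ i₂ ≡ p ^ 1 * toℕ t + toℕ c} →
                   i₁ ≡ i₂ → _≡_ {A = Path (V 1 c)} (start i₁ ▷ E1 t e₁) (start i₂ ▷ E1 t e₂)
    unique-start {i₁} refl = cong (λ e → start i₁ ▷ E1 t e) (≡-irrelevant _ _)

  sumOver-initial : ∀ c (f : Path (V 1 c) → ℕ) → sumOver (paths-V 1 c) f ≡ sumOver (enumFin (p ∸ 1)) (f ∘ initial c)
  sumOver-initial c f = trans
    (sumOver-unique (paths-V 1 c) (enumMap (initial c) initial⁻¹ (λ _ → refl) initial-initial⁻¹ (enumFin (p ∸ 1))) f)
    (sumOver-enumMap (initial c) initial⁻¹ (λ _ → refl) initial-initial⁻¹ (enumFin (p ∸ 1)) f)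

  -- There are p - 1 choices for the first edge and p for each of the s digits before `c`.
  count : ∀ s c → sumOver (paths-V (suc s) c) (λ _ → 1) ≡ (p ∸ 1) * p ^ s
  count zero c = trans (sumOver-initial c (λ _ → 1)) (trans (∑-1 (p ∸ 1)) (sym (*-identityʳ (p ∸ 1))))
  count (suc s) c = begin
    sumOver (paths-V (2+ s) c) (λ _ → 1)
      ≡⟨ sumOver-extend s c (λ _ → 1) ⟩
    sumOver (enumFin (p ^ 1)) (λ b → sumOver (paths-V (suc s) b) (λ _ → 1))
      ≡⟨ sumOver-cong (enumFin (p ^ 1)) (count s) ⟩
    ∑ (p ^ 1) (λ _ → (p ∸ 1) * p ^ s)
      ≡⟨ ∑-const (p ^ 1) _ ⟩
    p ^ 1 * ((p ∸ 1) * p ^ s)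
      ≡⟨ swap p (p ∸ 1) (p ^ s) ⟩
    (p ∸ 1) * (p * p ^ s) ∎
    where
    open ≡-Reasoning
    swap : ∀ p r z → p * 1 * (r * z) ≡ r * (p * z)
    swap = solve-∀

  -- Labels and descents in terms of digits.

  up-label : ∀ s b c → let n = (p ∸ 1) * toℕ b + toℕ c in label (up s b c) ≡ B (p * (p ∸ 1) ∸ n) n
  up-label s b c = cong₂ (λ z y → B (z * (p ∸ 1) ∸ ((p ∸ 1) * toℕ b + y)) ((p ∸ 1) * toℕ b + y))
    (^-identityʳ p) (toℕ-cast (^-identityʳ p) c)

  down-label : ∀ s b c → label (down s b c) ≡ B (p * toℕ b) (p * (p ∸ 1 ∸ toℕ b))
  down-label s b c = cong₂ (λ z y → B (z * y) (z * (p ∸ 1 ∸ y)))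
    (^-identityʳ p) (E2-quotient {digits b c} {b} (digit c) (toℕ-digits b c))

  up-size : ∀ (b c : Fin (p ^ 1)) → let n = (p ∸ 1) * toℕ b + toℕ c in p * (p ∸ 1) ∸ n + n ≡ p * (p ∸ 1)
  up-size b c = m∸n+n≡m (begin
    (p ∸ 1) * toℕ b + toℕ c    ≤⟨ +-monoʳ-≤ ((p ∸ 1) * toℕ b) (toℕ≤p∸1 c) ⟩
    (p ∸ 1) * toℕ b + (p ∸ 1)  ≡⟨ +-comm ((p ∸ 1) * toℕ b) (p ∸ 1) ⟩
    (p ∸ 1) + (p ∸ 1) * toℕ b  ≡⟨ *-suc (p ∸ 1) (toℕ b) ⟨
    (p ∸ 1) * suc (toℕ b)      ≤⟨ *-monoʳ-≤ (p ∸ 1) (toℕ<p b) ⟩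
    (p ∸ 1) * p                ≡⟨ *-comm (p ∸ 1) p ⟩
    p * (p ∸ 1)                ∎)
    where open ≤-Reasoning

  down-size : ∀ (b : Fin (p ^ 1)) → p * toℕ b + p * (p ∸ 1 ∸ toℕ b) ≡ p * (p ∸ 1)
  down-size b = trans (sym (*-distribˡ-+ p (toℕ b) _)) (cong (p *_) (m+[n∸m]≡n (toℕ≤p∸1 b)))

  top≥2 : ∀ {s l} (P : Path (V (suc s) l)) → 2 ≤ top P
  top≥2 (P ▷ _) = s≤s (top≥1 P)

  -- The index `suc (top P)` is at least 3, so there the two new blocks are compared. The index
  -- `top P` stays unevaluated: it is 2, never a descent, if `P` ends at a V_1, and a genuine
  -- comparison otherwise.
  des-extend : ∀ {s} b c (P : Path (V (suc s) b)) →
    des (extend c (b , P)) ≡ des P + ⟦ isDescent? (P ▷ up s b c) (top P) ⟧ + δ₁ p (toℕ b) (toℕ c)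
  des-extend {s} b c P = trans (des-▷ (P ▷ up s b c) (down s b c)) (cong₂ _+_ (des-▷ P (up s b c))
    (⟦⟧-cong (isDescent? (P ▷ up s b c ▷ down s b c) (suc (top P))) (_ <? _) descent⇔))
    where
    descent⇔ : IsDescent (P ▷ up s b c ▷ down s b c) (suc (top P)) ⇔
               ((p ∸ 1) * toℕ b + toℕ c + p * toℕ b < p * (p ∸ 1))
    descent⇔ = ≻⇔lower (up-size b c) (down-size b) ⇔-∘
      IsDescent-top (P ▷ up s b c) (down s b c) (s≤s (top≥2 P))
        (trans (block-new P (up s b c)) (up-label s b c)) (down-label s b c)

  -- One more known digit `a` fixes the last block before the extension, so the test left open in
  -- `des-extend` becomes `δ₂`.
  des-extend-extend : ∀ {s} a b c (P : Path (V (suc s) a)) →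
    des (extend c (b , extend b (a , P))) ≡
    des (extend b (a , P)) + (δ₂ p (toℕ a) (toℕ b) (toℕ c) + δ₁ p (toℕ b) (toℕ c))
  des-extend-extend {s} a b c P = trans (des-extend b c Q) (trans
    (cong (λ z → des Q + z + δ₁ p (toℕ b) (toℕ c))
      (⟦⟧-cong (isDescent? (Q ▷ up (suc s) b c) (top Q)) (_ <? _) descent⇔))
    (+-assoc (des Q) _ _))
    where
    Q = extend b (a , P)
    descent⇔ : IsDescent (Q ▷ up (suc s) b c) (top Q) ⇔
               (p * (p ∸ 1) < p * toℕ a + ((p ∸ 1) * toℕ b + toℕ c))
    descent⇔ = ≻⇔upper (down-size a) (up-size b c) ⇔-∘
      IsDescent-top Q (up (suc s) b c) (s≤s (s≤s (top≥1 P)))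
        (trans (block-new (P ▷ up s a b) (down s a b)) (down-label s a b)) (up-label (suc s) b c)

  des-initial : ∀ c t → des (initial c t) ≡ ⟦ toℕ t <? q ⟧
  des-initial c t = trans (des-▷ (start i) e) (⟦⟧-cong (isDescent? (start i ▷ e) 1) (toℕ t <? q) (mk⇔ to from))
    where
    i = fromℕ< (origin< c t)
    e : Edge (S i) (V 1 c)
    e = E1 t (toℕ-fromℕ< (origin< c t))
    to : IsDescent (start i ▷ e) 1 → toℕ t < q
    to (t′ , eq) = subst (_< q) (sym (*-cancelˡ-≡ (toℕ t) (toℕ t′) (p ^ 1) eq)) (toℕ<n t′)
    from : toℕ t < q → IsDescent (start i ▷ e) 1
    from t<q = fromℕ< t<q , cong (p ^ 1 *_) (sym (toℕ-fromℕ< t<q))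

  -- Initial values and the recursion.

  𝓜-V₁ : ∀ c → 𝓜 (V 1 c) ≡ q
  𝓜-V₁ c = trans (sumOver-initial c des) (trans (sumOver-cong (enumFin (p ∸ 1)) (des-initial c)) (∑-⟦<⟧ q≤p∸1))
    where
    q≤p∸1 : q ≤ p ∸ 1
    q≤p∸1 = subst (q ≤_) (sym (cong (_∸ 1) p≡1+2q)) (m≤n*m q 2)

  sumOver-paths-+ : ∀ s b (f : Path (V (suc s) b) → ℕ) n →
    sumOver (paths-V (suc s) b) (λ P → f P + n) ≡ sumOver (paths-V (suc s) b) f + (p ∸ 1) * p ^ s * n
  sumOver-paths-+ s b f n = trans (sumOver-+ (paths-V (suc s) b) f (λ _ → n))
    (cong (_+_ (sumOver (paths-V (suc s) b) f))
      (trans (sumOver-const (paths-V (suc s) b) n) (trans (cong (n *_) (count s b)) (*-comm n _))))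

  ∑-δ₁-p^1 : (c : Fin (p ^ 1)) → ∑ (p ^ 1) (λ b → δ₁ p b (toℕ c)) ≡ q + ⟦ toℕ c <? q ⟧
  ∑-δ₁-p^1 c = trans (∑-p^1 (λ b → δ₁ p b (toℕ c))) (∑-δ₁ {q = q} p≡1+2q (toℕ<p c))

  ∑-δ₂-p^1 : (b c : Fin (p ^ 1)) → ∑ (p ^ 1) (λ a → δ₂ p a (toℕ b) (toℕ c)) ≡ toℕ b + ⟦ toℕ b <? toℕ c ⟧
  ∑-δ₂-p^1 b c = trans (∑-p^1 (λ a → δ₂ p a (toℕ b) (toℕ c)))
    (atSuc p≡1+[p∸1] (toℕ<p b) (toℕ<p c))
    where
    -- `∑-δ₂` needs a literal successor, while p is fixed; generalising p to n allows matching on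
    -- the equation.
    atSuc : ∀ {n r b c} → n ≡ suc r → b < n → c < n → ∑ n (λ a → δ₂ n a b c) ≡ b + ⟦ b <? c ⟧
    atSuc refl = ∑-δ₂

  ∑-⟦<q⟧ : ∑ (p ^ 1) (λ b → ⟦ b <? q ⟧) ≡ q
  ∑-⟦<q⟧ = trans (∑-p^1 (λ b → ⟦ b <? q ⟧))
    (∑-⟦<⟧ (subst (q ≤_) (sym p≡1+2q) (m≤n⇒m≤1+n (m≤n*m q 2))))

  ∑-id-p^1 : ∑ (p ^ 1) id ≡ p * q
  ∑-id-p^1 = trans (∑-p^1 id) (∑-id-odd p≡1+2q)

  ∑-const-p^1 : ∀ n → ∑ (p ^ 1) (λ _ → n) ≡ p * n
  ∑-const-p^1 n = trans (∑-p^1 (λ _ → n)) (∑-const p n)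

  𝓜-V₂ : ∀ c → 𝓜 (V 2 c) ≡ p * q + (p ∸ 1) * (q + ⟦ toℕ c <? q ⟧)
  𝓜-V₂ c = begin
    𝓜 (V 2 c)
      ≡⟨ sumOver-extend 0 c des ⟩
    sumOver Fp (λ b → sumOver (paths-V 1 b) (λ P → des (extend c (b , P))))
      ≡⟨ sumOver-cong Fp (λ b → trans (sumOver-cong (paths-V 1 b) (des-extend-V₁ b)) (sumOver-paths-+ 0 b des (δ b))) ⟩
    sumOver Fp (λ b → 𝓜 (V 1 b) + (p ∸ 1) * 1 * δ b)
      ≡⟨ sumOver-cong Fp (λ b → cong₂ _+_ (𝓜-V₁ b) (cong (_* δ b) (*-identityʳ (p ∸ 1)))) ⟩
    sumOver Fp (λ b → q + (p ∸ 1) * δ b)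
      ≡⟨ sumOver-+ Fp (λ _ → q) (λ b → (p ∸ 1) * δ b) ⟩
    ∑ (p ^ 1) (λ _ → q) + sumOver Fp (λ b → (p ∸ 1) * δ b)
      ≡⟨ cong₂ _+_ (∑-const-p^1 q) (trans (sumOver-*ˡ Fp (p ∸ 1) δ) (cong ((p ∸ 1) *_) (∑-δ₁-p^1 c))) ⟩
    p * q + (p ∸ 1) * (q + ⟦ toℕ c <? q ⟧) ∎
    where
    open ≡-Reasoning
    Fp = enumFin (p ^ 1)
    δ : Fin (p ^ 1) → ℕ
    δ b = δ₁ p (toℕ b) (toℕ c)
    des-extend-V₁ : ∀ b (P : Path (V 1 b)) → des (extend c (b , P)) ≡ des P + δ b
    -- Exposing the shape of `P` makes `top P` compute to 2, whose bracket is 0 by definition.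
    des-extend-V₁ b P@(start _ ▷ E1 _ _) = trans (des-extend b c P) (cong (_+ δ b) (+-identityʳ (des P)))

  -- The last two digits a and b before c are split off. The descents of the shorter paths recombine
  -- to 𝓜 at V_b; the two new tests depend only on a, b, c, so each is weighted by the number of
  -- paths to V_a. Summing over a counts `δ₂` and multiplies `δ₁`, which is free of a, by p.
  𝓜-V₃₊ : ∀ s c → 𝓜 (V (3 + s) c) ≡
    sumOver (enumFin (p ^ 1)) (λ b → 𝓜 (V (2+ s) b)) +
    (p ∸ 1) * p ^ s * (p * q + toℕ c + p * (q + ⟦ toℕ c <? q ⟧))
  𝓜-V₃₊ s c = begin
    𝓜 (V (3 + s) c)
      ≡⟨ sumOver-extend (suc s) c des ⟩
    sumOver Fp (λ b → sumOver (paths-V (2+ s) b) (λ Q → des (extend c (b , Q))))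
      ≡⟨ sumOver-cong Fp inner ⟩
    sumOver Fp (λ b → 𝓜 (V (2+ s) b) + N * (toℕ b + ⟦ toℕ b <? toℕ c ⟧ + p * ε b))
      ≡⟨ sumOver-+ Fp (λ b → 𝓜 (V (2+ s) b)) _ ⟩
    M + sumOver Fp (λ b → N * (toℕ b + ⟦ toℕ b <? toℕ c ⟧ + p * ε b))
      ≡⟨ cong (_+_ M) (sumOver-*ˡ Fp N _) ⟩
    M + N * sumOver Fp (λ b → toℕ b + ⟦ toℕ b <? toℕ c ⟧ + p * ε b)
      ≡⟨ cong (λ z → M + N * z) (sumOver-+ Fp (λ b → toℕ b + ⟦ toℕ b <? toℕ c ⟧) (λ b → p * ε b)) ⟩
    M + N * (∑ (p ^ 1) (λ b → b + ⟦ b <? toℕ c ⟧) + sumOver Fp (λ b → p * ε b))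
      ≡⟨ cong (λ z → M + N * z) (cong₂ _+_
           (trans (∑-carry (<⇒≤ (toℕ<n c))) (cong (_+ toℕ c) ∑-id-p^1))
           (trans (sumOver-*ˡ Fp p ε) (cong (p *_) (∑-δ₁-p^1 c)))) ⟩
    M + N * (p * q + toℕ c + p * (q + ⟦ toℕ c <? q ⟧)) ∎
    where
    open ≡-Reasoning
    Fp = enumFin (p ^ 1)
    N = (p ∸ 1) * p ^ s
    M = sumOver Fp (λ b → 𝓜 (V (2+ s) b))
    ε : Fin (p ^ 1) → ℕ
    ε b = δ₁ p (toℕ b) (toℕ c)
    inner : ∀ b → sumOver (paths-V (2+ s) b) (λ Q → des (extend c (b , Q))) ≡
                  𝓜 (V (2+ s) b) + N * (toℕ b + ⟦ toℕ b <? toℕ c ⟧ + p * ε b)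
    inner b = begin
      sumOver (paths-V (2+ s) b) (λ Q → des (extend c (b , Q)))
        ≡⟨ sumOver-extend s b (λ Q → des (extend c (b , Q))) ⟩
      sumOver Fp (λ a → sumOver (paths-V (suc s) a) (λ P → des (extend c (b , extend b (a , P)))))
        ≡⟨ sumOver-cong Fp (λ a → trans
             (sumOver-cong (paths-V (suc s) a) (des-extend-extend a b c))
             (sumOver-paths-+ s a (λ P → des (extend b (a , P))) (ζ a + ε b))) ⟩
      sumOver Fp (λ a → sumOver (paths-V (suc s) a) (λ P → des (extend b (a , P))) + N * (ζ a + ε b))
        ≡⟨ sumOver-+ Fp _ (λ a → N * (ζ a + ε b)) ⟩
      sumOver Fp (λ a → sumOver (paths-V (suc s) a) (λ P → des (extend b (a , P)))) + sumOver Fp (λ a → N * (ζ a + ε b))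
        ≡⟨ cong₂ _+_ (sym (sumOver-extend s b des)) (sumOver-*ˡ Fp N (λ a → ζ a + ε b)) ⟩
      𝓜 (V (2+ s) b) + N * sumOver Fp (λ a → ζ a + ε b)
        ≡⟨ cong (λ z → 𝓜 (V (2+ s) b) + N * z) (trans (sumOver-+ Fp ζ (λ _ → ε b))
             (cong₂ _+_ (∑-δ₂-p^1 b c) (∑-const-p^1 (ε b)))) ⟩
      𝓜 (V (2+ s) b) + N * (toℕ b + ⟦ toℕ b <? toℕ c ⟧ + p * ε b) ∎
      where
      ζ : Fin (p ^ 1) → ℕ
      ζ a = δ₂ p (toℕ a) (toℕ b) (toℕ c)

  -- The closed form.

  -- 4 q² + 4 q is p² - 1.
  K : ℕ → ℕ
  K s = p * p + (2 * s + 1) * (4 * q * q + 4 * q) + 4 * p * q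

  -- Over all digits b, both b and p [b < q] sum to p q, so the recursion changes only `K`; the
  -- dependence on c comes from the last extension alone.
  𝓜-closed : ∀ s c → 𝓜 (V (3 + s) c) ≡ p ^ s * q * (K s + 2 * (toℕ c + p * ⟦ toℕ c <? q ⟧))
  𝓜-closed zero c = trans (𝓜-V₃₊ 0 c) (trans
    (cong (_+ (p ∸ 1) * 1 * (p * q + toℕ c + p * (q + ⟦ toℕ c <? q ⟧))) sum-V₂)
    (identity (toℕ c) ⟦ toℕ c <? q ⟧ p≡1+2q))
    where
    Fp = enumFin (p ^ 1)
    sum-V₂ : sumOver Fp (λ b → 𝓜 (V 2 b)) ≡ p * (p * q) + (p ∸ 1) * (p * q + q)
    sum-V₂ = trans (sumOver-cong Fp 𝓜-V₂) (trans (sumOver-+ Fp (λ _ → p * q) _)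
      (cong₂ _+_ (∑-const-p^1 (p * q)) (trans (sumOver-*ˡ Fp (p ∸ 1) _) (cong ((p ∸ 1) *_)
        (trans (sumOver-+ Fp (λ _ → q) _) (cong₂ _+_ (∑-const-p^1 q) ∑-⟦<q⟧))))))
    identity : ∀ {p q} c u → p ≡ suc (2 * q) →
      p * (p * q) + (p ∸ 1) * (p * q + q) + (p ∸ 1) * 1 * (p * q + c + p * (q + u)) ≡
      1 * q * (p * p + 1 * (4 * q * q + 4 * q) + 4 * p * q + 2 * (c + p * u))
    -- Substituting p = 2q + 1 makes `p ∸ 1` compute to 2q, which leaves a polynomial identity
    -- without subtraction.
    identity {q = q} c u refl = ring q c u
      where
      ring : ∀ q c u → let p = 1 + 2 * q in
        p * (p * q) + 2 * q * (p * q + q) + 2 * q * 1 * (p * q + c + p * (q + u)) ≡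
        1 * q * (p * p + 1 * (4 * q * q + 4 * q) + 4 * p * q + 2 * (c + p * u))
      ring = solve-∀
  𝓜-closed (suc s) c = trans (𝓜-V₃₊ (suc s) c) (trans
    (cong (_+ (p ∸ 1) * p ^ suc s * (p * q + toℕ c + p * (q + ⟦ toℕ c <? q ⟧))) sum-V)
    (identity s (p ^ s) (toℕ c) ⟦ toℕ c <? q ⟧ p≡1+2q))
    where
    Fp = enumFin (p ^ 1)
    sum-V : sumOver Fp (λ b → 𝓜 (V (3 + s) b)) ≡ p ^ s * q * (p * K s + 2 * (p * q + p * q))
    sum-V = trans (sumOver-cong Fp (𝓜-closed s)) (trans (sumOver-*ˡ Fp (p ^ s * q) _)
      (cong (p ^ s * q *_) (trans (sumOver-+ Fp (λ _ → K s) _)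
        (cong₂ _+_ (∑-const-p^1 (K s)) (trans (sumOver-*ˡ Fp 2 _) (cong (2 *_)
          (trans (sumOver-+ Fp toℕ _) (cong₂ _+_ ∑-id-p^1 (trans (sumOver-*ˡ Fp p _) (cong (p *_) ∑-⟦<q⟧))))))))))
    identity : ∀ {p q} s z c u → p ≡ suc (2 * q) →
      z * q * (p * (p * p + (2 * s + 1) * (4 * q * q + 4 * q) + 4 * p * q) + 2 * (p * q + p * q)) +
        (p ∸ 1) * (p * z) * (p * q + c + p * (q + u)) ≡
      p * z * q * (p * p + (2 * suc s + 1) * (4 * q * q + 4 * q) + 4 * p * q + 2 * (c + p * u))
    identity {q = q} s z c u refl = ring q s z c u
      where
      ring : ∀ q s z c u → let p = 1 + 2 * q in
        z * q * (p * (p * p + (2 * s + 1) * (4 * q * q + 4 * q) + 4 * p * q) + 2 * (p * q + p * q)) +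
          2 * q * (p * z) * (p * q + c + p * (q + u)) ≡
        p * z * q * (p * p + (2 * (1 + s) + 1) * (4 * q * q + 4 * q) + 4 * p * q + 2 * (c + p * u))
      ring = solve-∀

  -- Comparison with the stated formula over the integers.

  -- Since p - 1 = 2q, the numerator is even and the division is exact.
  prefactor : ∀ s → p ^ s * (p ∸ 1) / 2 ≡ p ^ s * q
  prefactor s = trans
    (/-congˡ (trans (cong (p ^ s *_) (trans (cong (_∸ 1) p≡1+2q) (*-comm 2 q))) (sym (*-assoc (p ^ s) q 2))))
    (m*n/n≡m (p ^ s * q) 2)

  -- The subtracted term of the formula is moved to the left, so that the identity lives in ℕ. The
  -- remaining truncated difference is exact: it equals 2s + 1.
  K-low : ∀ s t → K s + 2 * (t + p * 1) + (2 * (3 + s) ∸ 5) ≡ 2 * (2 + s) * p ^ 2 + 2 * t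
  K-low s t = trans (cong (_+_ (K s + 2 * (t + p * 1))) (2s∸5 s)) (identity s t p≡1+2q)
    where
    identity : ∀ {p q} s t → p ≡ suc (2 * q) →
      p * p + (2 * s + 1) * (4 * q * q + 4 * q) + 4 * p * q + 2 * (t + p * 1) + suc (2 * s) ≡
      2 * (2 + s) * (p * (p * 1)) + 2 * t
    identity {q = q} s t refl = ring q s t
      where
      ring : ∀ q s t → let p = 1 + 2 * q in
        p * p + (2 * s + 1) * (4 * q * q + 4 * q) + 4 * p * q + 2 * (t + p * 1) + (1 + 2 * s) ≡
        2 * (2 + s) * (p * (p * 1)) + 2 * t
      ring = solve-∀
    2s∸5 : ∀ s → 2 * (3 + s) ∸ 5 ≡ suc (2 * s)
    2s∸5 s = cong (_∸ 5) (split s)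
      where
      split : ∀ s → 2 * (3 + s) ≡ 5 + (1 + 2 * s)
      split = solve-∀

  -- The bracket is now 0 instead of 1, which costs exactly 2p; restoring it reduces to `K-low`.
  K-high : ∀ s t → K s + 2 * (t + p * 0) + (2 * (3 + s) ∸ 5) + 2 * p ≡ 2 * (2 + s) * p ^ 2 + 2 * t
  K-high s t = trans (shift (K s) t p (2 * (3 + s) ∸ 5)) (K-low s t)
    where
    shift : ∀ k t p d → k + 2 * (t + p * 0) + d + 2 * p ≡ k + 2 * (t + p * 1) + d
    shift = solve-∀

pos-∸ : ∀ {m n o} → m + n ≡ o → + m ≡ + o ℤ.- + n
pos-∸ {m} {n} refl = sym (trans (ℤ.+-assoc (+ m) (+ n) (ℤ.- + n))
  (trans (cong (ℤ._+_ (+ m)) (ℤ.+-inverseʳ (+ n))) (ℤ.+-identityʳ (+ m))))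

mainTheorem6 : (p : ℕ) (p-prime : Prime p) (p-odd : ¬ 2 ∣ p) →
    let open Column p p-prime p-odd 1 in
    (s : ℕ) .{{_ : NonZero s}} → 3 ≤ s → (t : Fin p) →
    let v = V s (cast (sym (^-identityʳ p)) t) in
    (toℕ t < (p ∸ 1) / 2 →
    + 𝓜 v ≡ + (p ^ (s ∸ 3) * (p ∸ 1) / 2) ℤ.*
    (+ (2 * (s ∸ 1) * p ^ 2) ℤ.+ + (2 * toℕ t) ℤ.- + (2 * s ∸ 5)))
    ×
    ((p ∸ 1) / 2 ≤ toℕ t →
    + 𝓜 v ≡ + (p ^ (s ∸ 3) * (p ∸ 1) / 2) ℤ.*
    (+ (2 * (s ∸ 1) * p ^ 2) ℤ.+ + (2 * toℕ t) ℤ.- + (2 * p) ℤ.- + (2 * s ∸ 5)))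
mainTheorem6 p p-prime p-odd (suc (suc (suc s))) (s≤s (s≤s (s≤s z≤n))) t = low , high
  where
  open FirstColumn p p-prime p-odd
  open Column p p-prime p-odd 1 using (V; 𝓜)
  c = cast (sym (^-identityʳ p)) t
  value : ∀ {u} → ⟦ toℕ t <? q ⟧ ≡ u →
          + 𝓜 (V (3 + s) c) ≡ + (p ^ s * (p ∸ 1) / 2) ℤ.* + (K s + 2 * (toℕ t + p * u))
  value {u} eq = trans
    (cong +_ (trans (𝓜-closed s c) (cong₂ (λ f y → f * (K s + 2 * y)) (sym (prefactor s))
      (trans (cong (λ z → z + p * ⟦ z <? q ⟧) (toℕ-cast (sym (^-identityʳ p)) t)) (cong (λ z → toℕ t + p * z) eq)))))
    (ℤ.pos-* (p ^ s * (p ∸ 1) / 2) _)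
  low : toℕ t < q → _
  low t<q = trans (value (⟦⟧-yes (toℕ t <? q) t<q))
    (cong (+ (p ^ s * (p ∸ 1) / 2) ℤ.*_) (pos-∸ (K-low s (toℕ t))))
  high : q ≤ toℕ t → _
  high q≤t = trans (value (⟦⟧-no (toℕ t <? q) (≤⇒≯ q≤t)))
    (cong (+ (p ^ s * (p ∸ 1) / 2) ℤ.*_)
      -- The outermost difference comes from adding and subtracting the same constant; `K-high` then
      -- supplies the inner subtraction of 2p.
      (trans (pos-∸ {n = 2 * (3 + s) ∸ 5} refl) (cong (ℤ._- + (2 * (3 + s) ∸ 5)) (pos-∸ (K-high s (toℕ t))))))
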